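{- Let $m,n\ge 1$ and let $R=(r_1,\dots,r_m)$ and $S=(s_1,\dots,s_n)$ be vectors of nonnegative integers with $r_i\le n$ for all $i$, $s_j\le m$ for all $j$, and $\sum_i r_i=\sum_j s_j$. Let $o(R)$ and $o(S)$ denote the numbers of odd components of $R$ and $S$. Then $\mathcal{A}^{+}(R,S)\neq\emptyset$ if and only if all of the following hold: (a) $R$ and $S$ are both palindromic, i.e. $r_i=r_{m+1-i}$ for all $i$ and $s_j=s_{n+1-j}$ for all $j$; (b) if $n$ is even then every component of $R$ is even, and if $n$ is odd then $s_{\lceil n/2\rceil}\ge o(R)$; if $m$ is even then every component of $S$ is even, and if $m$ is odd then $r_{\lceil m/2\rceil}\ge o(S)$; (c) if $n$ is odd then $o(R)=s_{\lceil n/2\rceil}$, and if $m$ is odd then $o(S)=r_{\lceil m/2\rceil}$; (d) $\check{S}\preceq \check{R}^*$, where $\check{R}=(\lfloor r_1/2\rfloor,\lfloor r_2/2\rfloor,\dots,\lfloor r_{\lfloor m/2\rfloor}/2\rfloor)$ and $\check{S}=(\lfloor s_1/2\rfloor,\lfloor s_2/2\rfloor,\dots,\lfloor s_{\lfloor n/2\rfloor}/2\rfloor)$.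
   Context: $\mathcal{A}^{+}(R,S)$ is the set of $m\times n$ matrices $A$ with entries in $\{0,1\}$, with $i$th row sum $r_i$ and $j$th column sum $s_j$ for all $i,j$, that are invariant under the group $D_+=\{\rho_0,\rho_\pi,r_0,r_\infty\}$, where $\rho_0$ is the identity, $(r_\infty A)_{i,j}=a_{i,\,n+1-j}$, $(r_0 A)_{i,j}=a_{m+1-i,\,j}$ and $(\rho_\pi A)_{i,j}=a_{m+1-i,\,n+1-j}$. For a nonnegative integer vector $R$, $R^*$ denotes the conjugate of (the weakly decreasing rearrangement of) $R$ viewed as an integer partition: its $k$th component is the number of $i$ with $r_i\ge k$. For nonnegative integer vectors $U,V$, $V\preceq U$ ($V$ is majorized by $U$) means that, after rearranging both in weakly decreasing order (and padding with zeros to a common length), $u_1+\dots+u_\ell\ge v_1+\dots+v_\ell$ for all $\ell$, and the total sums of $U$ and $V$ are equal. -}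

module Defs where

open import Data.Nat using (ℕ; zero; suc; _≤_; _≤?_; s≤s; NonZero; ⌊_/2⌋; ⌈_/2⌉)
open import Data.Nat.Divisibility using (_∣_; _∤_; _∣?_)
open import Data.Nat.Properties using (≤-decTotalOrder; +-0-commutativeMonoid; ⌊n/2⌋≤n)
open import Data.Fin using (Fin; toℕ; fromℕ<; inject≤; opposite)
open import Data.Fin.Properties using (toℕ-fromℕ<)
import Data.Nat.ListAction as List
open import Data.List using (List; length; filter; take; applyUpTo)
open import Data.List.Extrema.Nat using (max)
open import Data.Product using (_×_)
open import Data.Vec.Functional using (Vector; toList)
open import Relation.Binary.PropositionalEquality using (_≡_; cong)
open import Relation.Nullary.Decidable using (¬?)
import Relation.Binary.Construct.Flip.Ord as Flip

open import Algebra.Properties.CommutativeMonoid.Sum +-0-commutativeMonoid public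
  using (sum)
-- Sorting with respect to _≥_, that is, into weakly decreasing order.
open import Data.List.Sort (Flip.decTotalOrder ≤-decTotalOrder) public
  using () renaming (sort to sort↓; sort-↭ to sort↓-↭; sort-↗ to sort↓-↘)

Matrix : ℕ → ℕ → Set
Matrix m n = Fin m → Fin n → Fin 2

data D₊ : Set where
  ρ₀ ρπ r₀ r∞ : D₊

-- On zero-based indices, `opposite` is the one-based reversal i ↦ m + 1 - i.
infixr 7 _·_
_·_ : ∀ {m n} → D₊ → Matrix m n → Matrix m n
(ρ₀ · A) i j = A i j
(ρπ · A) i j = A (opposite i) (opposite j)
(r₀ · A) i j = A (opposite i) j
(r∞ · A) i j = A i (opposite j)

record A⁺ {m n : ℕ} (R : Vector ℕ m) (S : Vector ℕ n) : Set where
  field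
    matrix    : Matrix m n
    rowSum    : ∀ i → sum (λ j → toℕ (matrix i j)) ≡ R i
    colSum    : ∀ j → sum (λ i → toℕ (matrix i j)) ≡ S j
    invariant : ∀ g i j → (g · matrix) i j ≡ matrix i j

Palindromic : ∀ {n} → Vector ℕ n → Set
Palindromic v = ∀ i → v i ≡ v (opposite i)

Even Odd : ℕ → Set
Even n = 2 ∣ n
Odd n = 2 ∤ n

#odd : ∀ {n} → Vector ℕ n → ℕ
#odd v = length (filter (λ x → ¬? (2 ∣? x)) (toList v))

-- The one-based position ⌈ n /2⌉, as a zero-based index.
mid : ∀ n .{{_ : NonZero n}} → Fin n
mid (suc n) = fromℕ< (s≤s (⌊n/2⌋≤n n))

toℕ-mid : ∀ n .{{_ : NonZero n}} → suc (toℕ (mid n)) ≡ ⌈ n /2⌉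
toℕ-mid (suc n) = cong suc (toℕ-fromℕ< (s≤s (⌊n/2⌋≤n n)))

check : ∀ {n} → Vector ℕ n → Vector ℕ ⌊ n /2⌋
check {n} v i = ⌊ v (inject≤ i (⌊n/2⌋≤n n)) /2⌋

-- The components of index k > max 0 xs all vanish, and are omitted.
conjugate : List ℕ → List ℕ
conjugate xs = applyUpTo (λ k → length (filter (suc k ≤?_) xs)) (max 0 xs)

-- V ⪯ U means that V is majorized by U.  As `take ℓ` returns the whole list
-- when ℓ exceeds its length, padding with zeros is implicit.
infix 4 _⪯_
_⪯_ : List ℕ → List ℕ → Set
V ⪯ U = (∀ ℓ → List.sum (take ℓ (sort↓ V)) ≤ List.sum (take ℓ (sort↓ U)))
      × List.sum V ≡ List.sum U

{-# OPTIONS --safe #-}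

-- Folding along both central lines reduces the statement to the Gale–Ryser
-- theorem for one quadrant.  The sum of a palindromic 0/1 line is its central
-- entry plus twice the sum over a half, so the floored halves of R and S are the
-- line sums of the quadrant and the parities are the entries on the central
-- lines, whose sums are therefore o(R) and o(S).
-- For the sufficiency in Gale–Ryser, the smallest column x is placed in the rows
-- of largest sum and removed.  If v is the threshold of this selection, then
-- Σ min(rᵢ, ℓ) is unchanged for ℓ ≤ v, while for ℓ > v its new value plus x is the
-- old Σ min(rᵢ, ℓ + 1); both preserve the domination of the remaining columns.
module Submission where

open import Data.Nat
open import Data.Nat.Properties
open import Data.Nat.Divisibility
open import Data.Nat.DivMod
open import Data.Nat.Solver using (module +-*-Solver)
import Data.Nat.ListAction as List
open import Data.Nat.ListAction.Properties using (sum-++; sum-↭)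
open import Data.Fin as Fin using (Fin; toℕ; fromℕ; fromℕ<; inject₁; inject≤; opposite; zero; suc)
open import Data.Fin.Properties using (nonZeroIndex; toℕ-fromℕ<; toℕ-injective; toℕ-inject₁; toℕ-inject≤; toℕ<n)
open import Data.Fin.Relation.Unary.Top using (view; ‵fromℕ; ‵inject₁; view-fromℕ; view-inject₁)
open import Data.List using (List; []; _∷_; _∷ʳ_; map; take; tabulate; applyUpTo; filter; length)
open import Data.List.Properties
  using (take-map; map-tabulate; map-++; map-id; map-∘; applyUpTo-∷ʳ; filter-accept; filter-reject; tabulate-cong; ∷-injective)
open import Data.List.Extrema.Nat using (max; xs≤max)
open import Data.List.Relation.Unary.All as All using (All; []; _∷_)
import Data.List.Relation.Unary.All.Properties as All
open import Data.List.Relation.Unary.AllPairs using (AllPairs; []; _∷_)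
import Data.List.Relation.Unary.Linked.Properties as Linked
open import Data.List.Relation.Unary.Sorted.TotalOrder.Properties using (Sorted⇒AllPairs; ↗↭↗⇒≋)
open import Data.List.Relation.Binary.Permutation.Propositional using (_↭_; ↭-sym; ↭-trans; ↭-reflexive; ↭⇒↭ₛ)
open import Data.List.Relation.Binary.Permutation.Propositional.Properties using (↭-map-inv; map⁺)
import Data.List.Relation.Binary.Permutation.Homogeneous as Permutation
open import Data.List.Relation.Binary.Pointwise as Pointwise using (Pointwise-≡⇒≡)
open import Data.List.Reverse using (Reverse; []; _∶_∶ʳ_; reverseView)
import Data.Maybe as Maybe
open import Data.Maybe using (Maybe; just; nothing)
open import Data.Product using (_×_; _,_; ∃; proj₁; proj₂)
open import Data.Sum using (_⊎_; inj₁; inj₂)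
open import Data.Vec.Functional using (Vector; toList)
open import Function using (_∘_; flip)
open import Function.Bundles using (_⇔_; mk⇔)
open import Relation.Binary using (Rel; module DecTotalOrder)
import Relation.Binary.Construct.Flip.Ord as Flip
open import Relation.Binary.PropositionalEquality
open import Relation.Nullary using (yes; no; contradiction)
open import Relation.Nullary.Decidable using (¬?)
open import Algebra.Properties.CommutativeMonoid.Sum +-0-commutativeMonoid
  using (sum-cong-≗; sum-init-last; sum-replicate-zero; ∑-distrib-+; ∑-comm)
open import Defs

private
  variable
    m n : ℕ

-- Sums of vectors and discrete interpolation

sum-mono-≤ : {f g : Vector ℕ n} → (∀ i → f i ≤ g i) → sum f ≤ sum g
sum-mono-≤ {zero}  f≤g = z≤n
sum-mono-≤ {suc n} f≤g = +-mono-≤ (f≤g zero) (sum-mono-≤ (f≤g ∘ suc))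

f[i]≤sum : (f : Vector ℕ n) → ∀ i → f i ≤ sum f
f[i]≤sum f zero    = m≤m+n _ _
f[i]≤sum f (suc i) = m≤n⇒m≤o+n (f zero) (f[i]≤sum (f ∘ suc) i)

sum-toList : (f : Vector ℕ n) → List.sum (toList f) ≡ sum f
sum-toList {zero}  f = refl
sum-toList {suc n} f = cong (f zero +_) (sum-toList (f ∘ suc))

-- Start from `f` and raise the entries to `g` one after another, last entry first, stopping when
-- the sum reaches `k`. In `select` this breaks the ties at the threshold.
sum-interpolate : (f g : Vector ℕ n) (k : ℕ) → (∀ i → f i ≤ g i) → sum f ≤ k → k ≤ sum g →
                  ∃ λ e → (∀ i → f i ≤ e i) × (∀ i → e i ≤ g i) × sum e ≡ k
sum-interpolate {zero} f g zero    f≤g _ _ = f , (λ ()) , (λ ()) , refl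
sum-interpolate {suc n} f g k f≤g Σf≤k k≤Σg with k ≤? f zero + sum (g ∘ suc)
... | yes k≤ =
  let f₀≤k = m+n≤o⇒m≤o (f zero) Σf≤k
      e , f≤e , e≤g , Σe≡ = sum-interpolate (f ∘ suc) (g ∘ suc) (k ∸ f zero) (f≤g ∘ suc)
        (m+n≤o⇒m≤o∸n _ (≤-trans (≤-reflexive (+-comm _ (f zero))) Σf≤k))
        (m≤n+o⇒m∸n≤o k (f zero) k≤)
  in (λ { zero → f zero ; (suc i) → e i })
   , (λ { zero → ≤-refl ; (suc i) → f≤e i })
   , (λ { zero → f≤g zero ; (suc i) → e≤g i })
   , trans (cong (f zero +_) Σe≡) (m+[n∸m]≡n f₀≤k)
... | no k≰ =
  let f₀+Σg≤k = <⇒≤ (≰⇒> k≰) in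
  (λ { zero → k ∸ sum (g ∘ suc) ; (suc i) → g (suc i) })
  , (λ { zero → m+n≤o⇒m≤o∸n (f zero) f₀+Σg≤k ; (suc i) → f≤g (suc i) })
  , (λ { zero → m≤n+o⇒m∸n≤o k (sum (g ∘ suc)) (≤-trans k≤Σg (≤-reflexive (+-comm (g zero) _))) ; (suc i) → ≤-refl })
  , m∸n+n≡m (m+n≤o⇒n≤o (f zero) f₀+Σg≤k)

-- Searches downwards from `K`, keeping `h (suc K) ≤ k`, until the next value is no longer at most
-- `k` or 0 is reached.
crossing : (h : ℕ → ℕ) (k K : ℕ) → k ≤ h 0 → h (suc K) ≤ k → ∃ λ v → h (suc v) ≤ k × k ≤ h v
crossing h k zero    k≤h₀ h≤k = 0 , h≤k , k≤h₀
crossing h k (suc K) k≤h₀ h≤k with h (suc K) ≤? k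
... | yes h′≤k = crossing h k K k≤h₀ h′≤k
... | no  h′≰k = suc K , h≤k , <⇒≤ (≰⇒> h′≰k)

-- Removing the smallest column

total : Vector (Fin 2) m → ℕ
total c = sum (toℕ ∘ c)

rowTotal : List (Vector (Fin 2) m) → Vector ℕ m
rowTotal cs i = List.sum (map (λ c → toℕ (c i)) cs)

-- The entry c of a column which fills the rows of largest sum r, ties at
-- suc v being broken arbitrarily.
Threshold : ℕ → ℕ → Fin 2 → Set
Threshold v r c = (c ≡ zero × r ≤ suc v) ⊎ (c ≡ suc zero × v < r)

-- `1 ⊓ (x ∸ v)` is the indicator of `v < x`. In this form the indicator for `suc v` lies below the
-- one for `v` by monotonicity alone.
#above : Vector ℕ m → ℕ → ℕ
#above r v = sum (λ i → 1 ⊓ (r i ∸ v))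

-- Take `v` where `#above r` crosses `k`. A column lying between the indicators of `suc v < r i` and
-- `v < r i` is free only in the rows with `r i` equal to `suc v`, and interpolation gives it the
-- sum `k`.
select : (r : Vector ℕ m) (k : ℕ) → k ≤ #above r 0 →
         ∃ λ v → ∃ λ c → total c ≡ k × (∀ i → Threshold v (r i) (c i))
select {m} r k k≤ =
  -- The search starts at `sum r`: no entry exceeds `sum r`, so the count above `suc (sum r)` is 0.
  let v , above≤k , k≤above = crossing (#above r) k (sum r) k≤ (≤-trans (≤-reflexive none) z≤n)
      e , f≤e , e≤g , Σe≡k = sum-interpolate _ _ k
        (λ i → ⊓-monoʳ-≤ 1 (∸-monoʳ-≤ (r i) (n≤1+n v))) above≤k k≤above
      e<2 = λ i → s≤s (≤-trans (e≤g i) (m⊓n≤m 1 _))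
  in v , (λ i → fromℕ< (e<2 i))
   , trans (sum-cong-≗ (λ i → toℕ-fromℕ< (e<2 i))) Σe≡k
   , λ i → threshold v (r i) (e i) (e<2 i) (f≤e i) (e≤g i)
  where
  none : #above r (suc (sum r)) ≡ 0
  none = trans
    (sum-cong-≗ (λ i → cong (1 ⊓_) (m≤n⇒m∸n≡0 (m≤n⇒m≤1+n (f[i]≤sum r i)))))
    (sum-replicate-zero m)

  threshold : ∀ v x e (e<2 : e < 2) → 1 ⊓ (x ∸ suc v) ≤ e → e ≤ 1 ⊓ (x ∸ v) → Threshold v x (fromℕ< e<2)
  threshold v x 0 (s≤s _) f≤e _ = inj₁ (refl , ≮⇒≥ λ 1+v<x →
    n≮0 (≤-trans (⊓-glb ≤-refl (m<n⇒0<n∸m 1+v<x)) f≤e))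
  threshold v x 1 (s≤s (s≤s _)) _ e≤g =
    inj₂ (refl , m∸n≢0⇒n<m (m<n⇒n≢0 (≤-trans e≤g (m⊓n≤n 1 _))))
  threshold v x (suc (suc e)) (s≤s (s≤s ())) _ _

Threshold⇒≤ : ∀ {v r c} → Threshold v r c → toℕ c ≤ r
Threshold⇒≤ (inj₁ (refl , _))   = z≤n
Threshold⇒≤ (inj₂ (refl , v<r)) = ≤-trans (s≤s z≤n) v<r

-- A selected row has `r > v ≥ ℓ`, so both `r` and `r ∸ 1` are cut down to `ℓ`.
Threshold-⊓-low : ∀ {v r c ℓ} → Threshold v r c → ℓ ≤ v → (r ∸ toℕ c) ⊓ ℓ ≡ r ⊓ ℓ
Threshold-⊓-low (inj₁ (refl , _)) ℓ≤v = refl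
Threshold-⊓-low (inj₂ (refl , s≤s v≤r)) ℓ≤v =
  trans (m≥n⇒m⊓n≡n ℓ≤r) (sym (m≥n⇒m⊓n≡n (m≤n⇒m≤1+n ℓ≤r)))
  where ℓ≤r = ≤-trans ℓ≤v v≤r

-- An unselected row has `r ≤ suc v ≤ ℓ` and is cut by neither cap; for a selected row, lowering
-- both `r` and the cap by one lowers the minimum by one.
Threshold-⊓-high : ∀ {v r c ℓ} → Threshold v r c → v < ℓ → (r ∸ toℕ c) ⊓ ℓ + toℕ c ≡ r ⊓ suc ℓ
Threshold-⊓-high (inj₁ (refl , r≤)) v<ℓ =
  trans (+-identityʳ _) (trans (m≤n⇒m⊓n≡m r≤ℓ) (sym (m≤n⇒m⊓n≡m (m≤n⇒m≤1+n r≤ℓ))))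
  where r≤ℓ = ≤-trans r≤ v<ℓ
Threshold-⊓-high (inj₂ (refl , s≤s v≤r)) v<ℓ = +-comm _ 1

-- The first `ℓ` parts of the conjugate of `r` add up to Σ min(rᵢ, ℓ), so for weakly decreasing `xs`
-- these are the inequalities of majorization by the conjugate.
Dominated : Vector ℕ m → List ℕ → Set
Dominated r xs = ∀ ℓ → List.sum (take ℓ xs) ≤ sum (λ i → r i ⊓ ℓ)

sum-take-∷ʳ-≥ : ∀ ℓ xs x → List.sum (take ℓ xs) ≤ List.sum (take ℓ (xs ∷ʳ x))
sum-take-∷ʳ-≥ zero    xs       x = z≤n
sum-take-∷ʳ-≥ (suc ℓ) []       x = z≤n
sum-take-∷ʳ-≥ (suc ℓ) (y ∷ xs) x = +-monoʳ-≤ y (sum-take-∷ʳ-≥ ℓ xs x)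

-- The longer prefix either gains one further entry, which is at least `x`, or is the whole list and
-- so contains the final `x`.
sum-take-min : ∀ ℓ xs x → All (x ≤_) xs →
               List.sum (take ℓ xs) + x ≤ List.sum (take (suc ℓ) (xs ∷ʳ x))
sum-take-min zero    []       x []         = m≤m+n x 0
sum-take-min (suc ℓ) []       x []         = m≤m+n x 0
sum-take-min zero    (y ∷ xs) x (x≤y ∷ _)  = ≤-trans x≤y (m≤m+n y 0)
sum-take-min (suc ℓ) (y ∷ xs) x (_ ∷ x≤xs) =
  ≤-trans (≤-reflexive (+-assoc y _ x)) (+-monoʳ-≤ y (sum-take-min ℓ xs x x≤xs))

removeColumn : (r : Vector ℕ m) (xs : List ℕ) (x : ℕ) → All (x ≤_) xs → Dominated r (xs ∷ʳ x) →
               ∃ λ c → total c ≡ x × (∀ i → toℕ (c i) ≤ r i)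
                     × Dominated (λ i → r i ∸ toℕ (c i)) xs
removeColumn r xs x x≤xs dom =
  let v , c , Σc≡x , th = select r x
        -- Domination at `ℓ = 1`: `x` is at most the first column sum, hence at most the number of
        -- nonzero rows.
        (≤-trans (sum-take-min 0 xs x x≤xs)
          (≤-trans (dom 1) (≤-reflexive (sum-cong-≗ (λ i → ⊓-comm (r i) 1)))))
  in c , Σc≡x , (λ i → Threshold⇒≤ (th i)) , λ ℓ → dominated v c Σc≡x th ℓ
  where
  open ≤-Reasoning
  dominated : ∀ v c → total c ≡ x → (∀ i → Threshold v (r i) (c i)) →
              Dominated (λ i → r i ∸ toℕ (c i)) xs
  dominated v c Σc≡x th ℓ with ℓ ≤? v
  ... | yes ℓ≤v = begin
    List.sum (take ℓ xs)                ≤⟨ sum-take-∷ʳ-≥ ℓ xs x ⟩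
    List.sum (take ℓ (xs ∷ʳ x))         ≤⟨ dom ℓ ⟩
    sum (λ i → r i ⊓ ℓ)                 ≡⟨ sum-cong-≗ (λ i → Threshold-⊓-low (th i) ℓ≤v) ⟨
    sum (λ i → (r i ∸ toℕ (c i)) ⊓ ℓ)   ∎
  -- After adding `x` to both sides this is domination at `suc ℓ`: `x` stands for one more column on
  -- the left and for the entries of `c` on the right.
  ... | no ℓ≰v = +-cancelʳ-≤ x _ _ (begin
    List.sum (take ℓ xs) + x                          ≤⟨ sum-take-min ℓ xs x x≤xs ⟩
    List.sum (take (suc ℓ) (xs ∷ʳ x))                 ≤⟨ dom (suc ℓ) ⟩
    sum (λ i → r i ⊓ suc ℓ)                           ≡⟨ sum-cong-≗ (λ i → Threshold-⊓-high (th i) (≰⇒> ℓ≰v)) ⟨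
    sum (λ i → (r i ∸ toℕ (c i)) ⊓ ℓ + toℕ (c i))     ≡⟨ ∑-distrib-+ (λ i → (r i ∸ toℕ (c i)) ⊓ ℓ) (toℕ ∘ c) ⟩
    sum (λ i → (r i ∸ toℕ (c i)) ⊓ ℓ) + total c       ≡⟨ cong (sum (λ i → (r i ∸ toℕ (c i)) ⊓ ℓ) +_) Σc≡x ⟩
    sum (λ i → (r i ∸ toℕ (c i)) ⊓ ℓ) + x             ∎)

-- Constructing columns with sorted sums

AllPairs-∷ʳ⁻ : ∀ {a ℓ} {A : Set a} {R : Rel A ℓ} {xs x} →
               AllPairs R (xs ∷ʳ x) → AllPairs R xs × All (λ y → R y x) xs
AllPairs-∷ʳ⁻ {xs = []}     _          = [] , []
AllPairs-∷ʳ⁻ {xs = y ∷ xs} (py ∷ pxs) =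
  let pxs′ , px = AllPairs-∷ʳ⁻ pxs
      py′ , yx  = All.∷ʳ⁻ py
  in py′ ∷ pxs′ , yx ∷ px

sum-∷ʳ : ∀ xs x → List.sum (xs ∷ʳ x) ≡ List.sum xs + x
sum-∷ʳ xs x = trans (sum-++ xs _) (cong (List.sum xs +_) (+-identityʳ x))

-- The induction runs from the end of the list because the smallest sum, which is removed first,
-- stands last there. With no columns left, the equality of totals forces `r` to vanish.
realize : ∀ {xs} → Reverse xs → AllPairs _≥_ xs → (r : Vector ℕ m) → Dominated r xs →
          List.sum xs ≡ sum r → ∃ λ cs → map total cs ≡ xs × (∀ i → rowTotal cs i ≡ r i)
realize [] _ r _ 0≡Σr = [] , refl , λ i → sym (n≤0⇒n≡0 (≤-trans (f[i]≤sum r i) (≤-reflexive (sym 0≡Σr))))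
realize (xs ∶ rev ∶ʳ x) sorted r dom Σ≡ =
  let xs↘ , x≤xs = AllPairs-∷ʳ⁻ sorted
      c , Σc≡x , c≤r , dom′ = removeColumn r xs x x≤xs dom
      -- Since `c` lies below `r`, the truncated subtraction is exact and both totals drop by `x`.
      Σr′ = +-cancelʳ-≡ x _ _ (begin
        List.sum xs + x                            ≡⟨ sum-∷ʳ xs x ⟨
        List.sum (xs ∷ʳ x)                         ≡⟨ Σ≡ ⟩
        sum r                                      ≡⟨ sum-cong-≗ (λ i → m∸n+n≡m (c≤r i)) ⟨
        sum (λ i → (r i ∸ toℕ (c i)) + toℕ (c i))  ≡⟨ ∑-distrib-+ (λ i → r i ∸ toℕ (c i)) (toℕ ∘ c) ⟩
        sum (λ i → r i ∸ toℕ (c i)) + total c      ≡⟨ cong (sum (λ i → r i ∸ toℕ (c i)) +_) Σc≡x ⟩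
        sum (λ i → r i ∸ toℕ (c i)) + x            ∎)
      cs , cols , rows = realize rev xs↘ _ dom′ Σr′
  in cs ∷ʳ c
   , trans (map-++ total cs _) (cong₂ _∷ʳ_ cols Σc≡x)
   , λ i → begin
       rowTotal (cs ∷ʳ c) i          ≡⟨ cong List.sum (map-++ (λ d → toℕ (d i)) cs _) ⟩
       List.sum (map (λ d → toℕ (d i)) cs ∷ʳ toℕ (c i)) ≡⟨ sum-∷ʳ (map _ cs) (toℕ (c i)) ⟩
       rowTotal cs i + toℕ (c i)     ≡⟨ cong (_+ toℕ (c i)) (rows i) ⟩
       r i ∸ toℕ (c i) + toℕ (c i)   ≡⟨ m∸n+n≡m (c≤r i) ⟩
       r i                           ∎
  where open ≡-Reasoning

sum-map-total : (cs : List (Vector (Fin 2) m)) → List.sum (map total cs) ≡ sum (rowTotal cs)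
sum-map-total {m} []   = sym (sum-replicate-zero m)
sum-map-total (c ∷ cs) =
  trans (cong (total c +_) (sum-map-total cs)) (sym (∑-distrib-+ (toℕ ∘ c) (rowTotal cs)))

sum-take≤sum : ∀ ℓ xs → List.sum (take ℓ xs) ≤ List.sum xs
sum-take≤sum zero    xs       = z≤n
sum-take≤sum (suc ℓ) []       = z≤n
sum-take≤sum (suc ℓ) (x ∷ xs) = +-monoʳ-≤ x (sum-take≤sum ℓ xs)

sum-take≤length : ∀ ℓ (ds : List (Fin 2)) → List.sum (take ℓ (map toℕ ds)) ≤ ℓ
sum-take≤length zero    ds              = z≤n
sum-take≤length (suc ℓ) []              = z≤n
sum-take≤length (suc ℓ) (zero ∷ ds)     = m≤n⇒m≤1+n (sum-take≤length ℓ ds)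
sum-take≤length (suc ℓ) (suc zero ∷ ds) = s≤s (sum-take≤length ℓ ds)

↭-preserves-rowTotal : {cs ds : List (Vector (Fin 2) m)} → cs ↭ ds → ∀ i → rowTotal cs i ≡ rowTotal ds i
↭-preserves-rowTotal cs↭ds i = sum-↭ (map⁺ _ cs↭ds)

-- Conjugate partitions

take-applyUpTo : ∀ {a} {A : Set a} (f : ℕ → A) ℓ K → take ℓ (applyUpTo f K) ≡ applyUpTo f (ℓ ⊓ K)
take-applyUpTo f zero    K       = refl
take-applyUpTo f (suc ℓ) zero    = refl
take-applyUpTo f (suc ℓ) (suc K) = cong (f 0 ∷_) (take-applyUpTo (f ∘ suc) ℓ K)

#≥ : List ℕ → ℕ → ℕ
#≥ xs k = length (filter (k ≤?_) xs)

#≥-anti : ∀ xs {j k} → j ≤ k → #≥ xs k ≤ #≥ xs j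
#≥-anti []       j≤k = z≤n
#≥-anti (x ∷ xs) {j} {k} j≤k with k ≤? x | j ≤? x
... | yes k≤x | yes j≤x rewrite filter-accept (k ≤?_) {xs = xs} k≤x | filter-accept (j ≤?_) {xs = xs} j≤x = s≤s (#≥-anti xs j≤k)
... | yes k≤x | no  j≰x with () ← j≰x (≤-trans j≤k k≤x)
... | no  k≰x | yes j≤x rewrite filter-reject (k ≤?_) {xs = xs} k≰x | filter-accept (j ≤?_) {xs = xs} j≤x = m≤n⇒m≤1+n (#≥-anti xs j≤k)
... | no  k≰x | no  j≰x rewrite filter-reject (k ≤?_) {xs = xs} k≰x | filter-reject (j ≤?_) {xs = xs} j≰x = #≥-anti xs j≤k

-- Raising the cap from `k` to `suc k` gains 1 at exactly the entries exceeding `k`.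
sum-⊓-suc : ∀ xs k → List.sum (map (_⊓ k) xs) + #≥ xs (suc k) ≡ List.sum (map (_⊓ suc k) xs)
sum-⊓-suc []       k = refl
sum-⊓-suc (x ∷ xs) k with suc k ≤? x
... | yes k<x rewrite filter-accept (suc k ≤?_) {xs = xs} k<x
                    | m≥n⇒m⊓n≡n (<⇒≤ k<x) | m≥n⇒m⊓n≡n k<x =
  trans (+-suc _ _) (cong suc (trans (+-assoc k _ _) (cong (k +_) (sum-⊓-suc xs k))))
... | no  k≮x rewrite filter-reject (suc k ≤?_) {xs = xs} k≮x
                    | m≤n⇒m⊓n≡m (≮⇒≥ k≮x) | m≤n⇒m⊓n≡m (m≤n⇒m≤1+n (≮⇒≥ k≮x)) =
  trans (+-assoc x _ _) (cong (x +_) (sum-⊓-suc xs k))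

-- Counts the cells in the first `K` columns of the Young diagram, by columns and by rows.
sum-#≥ : ∀ xs K → List.sum (applyUpTo (#≥ xs ∘ suc) K) ≡ List.sum (map (_⊓ K) xs)
sum-#≥ xs zero    = sym (sum-⊓0 xs)
  where
  sum-⊓0 : ∀ xs → List.sum (map (_⊓ 0) xs) ≡ 0
  sum-⊓0 []       = refl
  sum-⊓0 (x ∷ xs) = cong₂ _+_ (⊓-zeroʳ x) (sum-⊓0 xs)
sum-#≥ xs (suc K) = begin
  List.sum (applyUpTo (#≥ xs ∘ suc) (suc K))                    ≡⟨ cong List.sum (applyUpTo-∷ʳ (#≥ xs ∘ suc) K) ⟨
  List.sum (applyUpTo (#≥ xs ∘ suc) K ∷ʳ #≥ xs (suc K))         ≡⟨ sum-∷ʳ (applyUpTo (#≥ xs ∘ suc) K) _ ⟩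
  List.sum (applyUpTo (#≥ xs ∘ suc) K) + #≥ xs (suc K)          ≡⟨ cong (_+ #≥ xs (suc K)) (sum-#≥ xs K) ⟩
  List.sum (map (_⊓ K) xs) + #≥ xs (suc K)                      ≡⟨ sum-⊓-suc xs K ⟩
  List.sum (map (_⊓ suc K) xs)                                  ∎
  where open ≡-Reasoning

map-cong-All : ∀ {P : ℕ → Set} {f g : ℕ → ℕ} {xs} → (∀ {x} → P x → f x ≡ g x) → All P xs → map f xs ≡ map g xs
map-cong-All f≡g []         = refl
map-cong-All f≡g (px ∷ pxs) = cong₂ _∷_ (f≡g px) (map-cong-All f≡g pxs)

-- The conjugate stops at the largest entry of `xs`; capping at `ℓ` or at the minimum of `ℓ` and
-- that entry has the same effect on `xs`.
sum-take-conjugate : ∀ ℓ xs → List.sum (take ℓ (conjugate xs)) ≡ List.sum (map (_⊓ ℓ) xs)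
sum-take-conjugate ℓ xs = begin
  List.sum (take ℓ (conjugate xs))                      ≡⟨ cong List.sum (take-applyUpTo (#≥ xs ∘ suc) ℓ K) ⟩
  List.sum (applyUpTo (#≥ xs ∘ suc) (ℓ ⊓ K))            ≡⟨ sum-#≥ xs (ℓ ⊓ K) ⟩
  List.sum (map (_⊓ (ℓ ⊓ K)) xs)                        ≡⟨ cong List.sum (map-cong-All below (xs≤max 0 xs)) ⟩
  List.sum (map (_⊓ ℓ) xs)                              ∎
  where
  open ≡-Reasoning
  K = max 0 xs
  below : ∀ {x} → x ≤ K → x ⊓ (ℓ ⊓ K) ≡ x ⊓ ℓ
  below {x} x≤K = trans (sym (⊓-assoc x ℓ K)) (m≤n⇒m⊓n≡m (≤-trans (m⊓n≤m x ℓ) x≤K))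

sum-conjugate : ∀ xs → List.sum (conjugate xs) ≡ List.sum xs
sum-conjugate xs = trans (sum-#≥ xs (max 0 xs)) (cong List.sum
  (trans (map-cong-All m≤n⇒m⊓n≡m (xs≤max 0 xs)) (map-id xs)))

private module ≥-order = DecTotalOrder (Flip.decTotalOrder ≤-decTotalOrder)

-- The counts `#≥ xs k` decrease in `k`, so the conjugate is already sorted, and a sorted
-- rearrangement is unique.
sort↓-conjugate : ∀ xs → sort↓ (conjugate xs) ≡ conjugate xs
-- `≥-order` carries the flipped equality, hence `sym` on the way in and on the way out.
sort↓-conjugate xs = Pointwise-≡⇒≡ (Pointwise.map sym (↗↭↗⇒≋ ≥-order.totalOrder
  (sort↓-↘ (conjugate xs))
  (Linked.applyUpTo⁺₂ _ (max 0 xs) (λ k → #≥-anti xs (n≤1+n (suc k))))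
  (Permutation.map sym (↭⇒↭ₛ (sort↓-↭ (conjugate xs))))))

⊓-sums : (r : Vector ℕ m) → ∀ ℓ →
         List.sum (take ℓ (sort↓ (conjugate (toList r)))) ≡ sum (λ i → r i ⊓ ℓ)
⊓-sums r ℓ = begin
  List.sum (take ℓ (sort↓ (conjugate (toList r))))  ≡⟨ cong (List.sum ∘ take ℓ) (sort↓-conjugate (toList r)) ⟩
  List.sum (take ℓ (conjugate (toList r)))          ≡⟨ sum-take-conjugate ℓ (toList r) ⟩
  List.sum (map (_⊓ ℓ) (toList r))                  ≡⟨ cong List.sum (map-tabulate r (_⊓ ℓ)) ⟩
  List.sum (toList (λ i → r i ⊓ ℓ))                 ≡⟨ sum-toList (λ i → r i ⊓ ℓ) ⟩
  sum (λ i → r i ⊓ ℓ)                               ∎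
  where open ≡-Reasoning

⪯-conjugate⇒ : ∀ xs (r : Vector ℕ m) → xs ⪯ conjugate (toList r) →
               Dominated r (sort↓ xs) × List.sum xs ≡ sum r
⪯-conjugate⇒ xs r (dom , Σ≡) =
  (λ ℓ → ≤-trans (dom ℓ) (≤-reflexive (⊓-sums r ℓ))) ,
  trans Σ≡ (trans (sum-conjugate (toList r)) (sum-toList r))

⇒⪯-conjugate : ∀ xs (r : Vector ℕ m) → Dominated r (sort↓ xs) → List.sum xs ≡ sum r →
               xs ⪯ conjugate (toList r)
⇒⪯-conjugate xs r dom Σ≡ =
  (λ ℓ → ≤-trans (dom ℓ) (≤-reflexive (sym (⊓-sums r ℓ)))) ,
  trans Σ≡ (sym (trans (sum-conjugate (toList r)) (sum-toList r)))

-- The Gale-Ryser theorem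

-- Within the first `ℓ` columns a row has at most `ℓ` ones and at most its full total.
columns-dominated : (cs : List (Vector (Fin 2) m)) → Dominated (rowTotal cs) (map total cs)
columns-dominated cs ℓ = begin
  List.sum (take ℓ (map total cs))         ≡⟨ cong List.sum (take-map {f = total} ℓ cs) ⟩
  List.sum (map total (take ℓ cs))         ≡⟨ sum-map-total (take ℓ cs) ⟩
  sum (rowTotal (take ℓ cs))               ≤⟨ sum-mono-≤ (λ i → ⊓-glb (≤rowTotal i) (≤ℓ i)) ⟩
  sum (λ i → rowTotal cs i ⊓ ℓ)            ∎
  where
  open ≤-Reasoning
  ≤rowTotal : ∀ i → rowTotal (take ℓ cs) i ≤ rowTotal cs i
  ≤rowTotal i = begin
    rowTotal (take ℓ cs) i                           ≡⟨ cong List.sum (take-map {f = λ c → toℕ (c i)} ℓ cs) ⟨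
    List.sum (take ℓ (map (λ c → toℕ (c i)) cs))     ≤⟨ sum-take≤sum ℓ (map (λ c → toℕ (c i)) cs) ⟩
    rowTotal cs i                                    ∎
  ≤ℓ : ∀ i → rowTotal (take ℓ cs) i ≤ ℓ
  ≤ℓ i = begin
    rowTotal (take ℓ cs) i                           ≡⟨ cong List.sum (take-map {f = λ c → toℕ (c i)} ℓ cs) ⟨
    List.sum (take ℓ (map (λ c → toℕ (c i)) cs))     ≡⟨ cong (List.sum ∘ take ℓ) (map-∘ cs) ⟩
    List.sum (take ℓ (map toℕ (map (λ c → c i) cs))) ≤⟨ sum-take≤length ℓ (map (λ c → c i) cs) ⟩
    ℓ                                                ∎

gale-ryser-necessary : (Q : Matrix m n) {r : Vector ℕ m} {s : Vector ℕ n} →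
                       (∀ i → sum (λ j → toℕ (Q i j)) ≡ r i) → (∀ j → sum (λ i → toℕ (Q i j)) ≡ s j) →
                       toList s ⪯ conjugate (toList r)
gale-ryser-necessary {m} {n} Q {r} {s} rows cols =
  -- Sorting the column sums lifts to a rearrangement `ds` of the columns themselves, which leaves
  -- the row totals alone.
  let ds , sorted≡ , cs↭ds = ↭-map-inv total (↭-trans (↭-reflexive columns) (↭-sym (sort↓-↭ (toList s))))
  in ⇒⪯-conjugate (toList s) r (λ ℓ → begin
      List.sum (take ℓ (sort↓ (toList s)))      ≡⟨ cong (List.sum ∘ take ℓ) sorted≡ ⟩
      List.sum (take ℓ (map total ds))          ≤⟨ columns-dominated ds ℓ ⟩
      sum (λ i → rowTotal ds i ⊓ ℓ)             ≡⟨ sum-cong-≗ (λ i → cong (_⊓ ℓ)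
                                                     (trans (sym (↭-preserves-rowTotal cs↭ds i)) (rowTotals i))) ⟩
      sum (λ i → r i ⊓ ℓ)                       ∎)
    (trans (sum-toList s) (trans (sym (sum-cong-≗ cols))
      (trans (∑-comm (λ j i → toℕ (Q i j))) (sum-cong-≗ rows))))
  where
  open ≤-Reasoning
  cs : List (Vector (Fin 2) m)
  cs = tabulate (flip Q)
  columns : map total cs ≡ toList s
  columns = trans (map-tabulate (flip Q) total) (tabulate-cong cols)
  rowTotals : ∀ i → rowTotal cs i ≡ r i
  rowTotals i = trans (cong List.sum (map-tabulate (flip Q) (λ c → toℕ (c i)))) (trans (sum-toList (λ j → toℕ (Q i j))) (rows i))

map≡tabulate⁻ : ∀ {a b} {A : Set a} {B : Set b} (f : A → B) (xs : List A) (g : Vector B n) →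
                map f xs ≡ tabulate g → ∃ λ h → xs ≡ tabulate h × (∀ i → f (h i) ≡ g i)
map≡tabulate⁻ {zero}  f []       g _  = (λ ()) , refl , λ ()
map≡tabulate⁻ {suc n} f (x ∷ xs) g eq with fx≡ , eqs ← ∷-injective eq =
  let h , xs≡ , fh≡ = map≡tabulate⁻ f xs (g ∘ suc) eqs
  in (λ { zero → x ; (suc i) → h i }) , cong (x ∷_) xs≡ , λ { zero → fx≡ ; (suc i) → fh≡ i }

gale-ryser-sufficient : (r : Vector ℕ m) (s : Vector ℕ n) → toList s ⪯ conjugate (toList r) →
                        ∃ λ (Q : Matrix m n) → (∀ i → sum (λ j → toℕ (Q i j)) ≡ r i)
                                             × (∀ j → sum (λ i → toℕ (Q i j)) ≡ s j)
gale-ryser-sufficient r s s⪯r* =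
  let dom , Σ≡ = ⪯-conjugate⇒ (toList s) r s⪯r*
      sort↭ = sort↓-↭ (toList s)
      cs , cols , rows = realize (reverseView (sort↓ (toList s)))
        (Sorted⇒AllPairs ≥-order.totalOrder (sort↓-↘ (toList s))) r dom (trans (sum-↭ sort↭) Σ≡)
      -- The columns realize the sorted sums; here they are permuted back into the order of `s`.
      ds , s≡ , cs↭ds = ↭-map-inv total (↭-trans (↭-reflexive cols) sort↭)
      Qᵀ , ds≡ , total≡ = map≡tabulate⁻ total ds s (sym s≡)
  in flip Qᵀ
   , (λ i → begin
       sum (λ j → toℕ (Qᵀ j i))              ≡⟨ sum-toList (λ j → toℕ (Qᵀ j i)) ⟨
       List.sum (toList (λ j → toℕ (Qᵀ j i))) ≡⟨ cong List.sum (map-tabulate Qᵀ (λ c → toℕ (c i))) ⟨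
       rowTotal (tabulate Qᵀ) i              ≡⟨ cong (λ xs → rowTotal xs i) ds≡ ⟨
       rowTotal ds i                         ≡⟨ ↭-preserves-rowTotal cs↭ds i ⟨
       rowTotal cs i                         ≡⟨ rows i ⟩
       r i                                   ∎)
   , total≡
  where open ≡-Reasoning

-- Parities and halves

-- `_% 2` reduces by steps of two, as `⌊_/2⌋` does.
halves : ∀ x → x % 2 + ⌊ x /2⌋ * 2 ≡ x
halves 0             = refl
halves 1             = refl
halves (suc (suc x)) =
  trans (trans (+-suc (x % 2) _) (cong suc (+-suc (x % 2) _))) (cong (2 +_) (halves x))

⌊b+x*2/2⌋≡x : ∀ {b} → b < 2 → ∀ x → ⌊ b + x * 2 /2⌋ ≡ x
⌊b+x*2/2⌋≡x {0} _ zero    = refl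
⌊b+x*2/2⌋≡x {0} b<2 (suc x) = cong suc (⌊b+x*2/2⌋≡x b<2 x)
⌊b+x*2/2⌋≡x {1} _ zero    = refl
⌊b+x*2/2⌋≡x {1} b<2 (suc x) = cong suc (⌊b+x*2/2⌋≡x b<2 x)
⌊b+x*2/2⌋≡x {suc (suc _)} (s≤s (s≤s ())) _

[b+x*2]%2≡b : ∀ {b} → b < 2 → ∀ x → (b + x * 2) % 2 ≡ b
[b+x*2]%2≡b {b} b<2 x = trans ([m+kn]%n≡m%n b x 2) (m<n⇒m%n≡m b<2)

Odd⇒%2≡1 : ∀ {x} → Odd x → x % 2 ≡ 1
Odd⇒%2≡1 {x} odd with x % 2 in eq | m%n<n x 2
... | 0 | _ = contradiction (m%n≡0⇒n∣m x 2 eq) odd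
... | 1 | _ = refl
... | suc (suc _) | s≤s (s≤s ())

Even⇒%2≡0 : ∀ {x} → Even x → x % 2 ≡ 0
Even⇒%2≡0 {x} = n∣m⇒m%n≡0 x 2

#odd≡sum-%2 : (v : Vector ℕ n) → #odd v ≡ sum (λ i → v i % 2)
#odd≡sum-%2 {zero}  v = refl
#odd≡sum-%2 {suc n} v with 2 ∣? v zero
... | yes even = trans
  (cong length (filter-reject (λ x → ¬? (2 ∣? x)) {xs = toList (v ∘ suc)} (λ odd → odd even)))
  (cong₂ _+_ (sym (Even⇒%2≡0 even)) (#odd≡sum-%2 (v ∘ suc)))
... | no odd   = trans
  (cong length (filter-accept (λ x → ¬? (2 ∣? x)) {xs = toList (v ∘ suc)} odd))
  (cong₂ _+_ (sym (Odd⇒%2≡1 odd)) (#odd≡sum-%2 (v ∘ suc)))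

#odd%2≡sum%2 : (v : Vector ℕ n) → #odd v % 2 ≡ sum v % 2
#odd%2≡sum%2 v = trans (cong (_% 2) (#odd≡sum-%2 v)) (sum-%2 v)
  where
  sum-%2 : ∀ {n} (v : Vector ℕ n) → sum (λ i → v i % 2) % 2 ≡ sum v % 2
  sum-%2 {zero}  v = refl
  sum-%2 {suc n} v = begin
    (v zero % 2 + sum (λ i → v (suc i) % 2)) % 2              ≡⟨ %-distribˡ-+ (v zero % 2) _ 2 ⟩
    (v zero % 2 % 2 + sum (λ i → v (suc i) % 2) % 2) % 2      ≡⟨ cong₂ (λ x y → (x + y) % 2) (m%n%n≡m%n (v zero) 2) (sum-%2 (v ∘ suc)) ⟩
    (v zero % 2 + sum (v ∘ suc) % 2) % 2                      ≡⟨ %-distribˡ-+ (v zero) _ 2 ⟨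
    (v zero + sum (v ∘ suc)) % 2                              ∎
    where open ≡-Reasoning

-- Reversal of indices and palindromic sums

-- The index embedding used by `check`.
half : Fin ⌊ n /2⌋ → Fin n
half {n} i = inject≤ i (⌊n/2⌋≤n n)

-- Dropping both ends matches the recursion of `⌊_/2⌋` and commutes with reversal, so the inductions
-- below run through it.
inner : ∀ {a} {A : Set a} → Vector A (2 + n) → Vector A n
inner f i = f (suc (inject₁ i))

half-suc : (i : Fin ⌊ n /2⌋) → half {2 + n} (suc i) ≡ suc (inject₁ (half i))
half-suc {n} i = toℕ-injective (trans (toℕ-inject≤ (suc i) (⌊n/2⌋≤n (2 + n)))
  (cong suc (sym (trans (toℕ-inject₁ (half i)) (toℕ-inject≤ i (⌊n/2⌋≤n n))))))

mid-suc : .{{_ : NonZero n}} → mid (2 + n) ≡ suc (inject₁ (mid n))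
mid-suc {suc n} = toℕ-injective (trans (toℕ-fromℕ< (s≤s (⌊n/2⌋≤n (2 + n))))
  (cong suc (sym (trans (toℕ-inject₁ (mid (suc n))) (toℕ-fromℕ< (s≤s (⌊n/2⌋≤n n)))))))

opposite-inject₁ : (i : Fin n) → opposite (inject₁ i) ≡ suc (opposite i)
opposite-inject₁ zero    = refl
opposite-inject₁ (suc i) = cong inject₁ (opposite-inject₁ i)

opposite-fromℕ : ∀ n → opposite (fromℕ n) ≡ zero
opposite-fromℕ zero    = refl
opposite-fromℕ (suc n) = cong inject₁ (opposite-fromℕ n)

inner-palindromic : (f : Vector ℕ (2 + n)) → Palindromic f → Palindromic (inner f)
inner-palindromic f pal i = trans (pal (suc (inject₁ i))) (cong (f ∘ inject₁) (opposite-inject₁ i))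

Odd-2+⁻ : Odd (2 + n) → Odd n
Odd-2+⁻ odd even = odd (∣m∣n⇒∣m+n ∣-refl even)

Even-2+⁻ : Even (2 + n) → Even n
Even-2+⁻ even = ∣m+n∣m⇒∣n even ∣-refl

-- The central entry, with value 0 for even `n`, so that `sum-palindromic` covers both parities at
-- once.
midTerm : ∀ n → Vector ℕ n → ℕ
midTerm 0             f = 0
midTerm 1             f = f zero
midTerm (suc (suc n)) f = midTerm n (inner f)

midTerm-Even : (f : Vector ℕ n) → Even n → midTerm n f ≡ 0
midTerm-Even {0}           f _    = refl
midTerm-Even {1}           f even with () ← ∣1⇒≡1 even
midTerm-Even {suc (suc n)} f even = midTerm-Even (inner f) (Even-2+⁻ even)

midTerm-Odd : .{{_ : NonZero n}} (f : Vector ℕ n) → Odd n → midTerm n f ≡ f (mid n)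
midTerm-Odd {1}                 f odd = refl
midTerm-Odd {2}                 f odd = contradiction ∣-refl odd
midTerm-Odd {suc (suc (suc n))} f odd =
  trans (midTerm-Odd (inner f) (Odd-2+⁻ odd)) (cong f (sym mid-suc))

-- For `k = 2` it makes the central term of a 0/1 line a remainder modulo 2; `0 < k` covers the
-- default value.
midTerm-bound : ∀ {k} (f : Vector ℕ n) → 0 < k → (∀ i → f i < k) → midTerm n f < k
midTerm-bound {0}           f 0<k f<k = 0<k
midTerm-bound {1}           f 0<k f<k = f<k zero
midTerm-bound {suc (suc n)} f 0<k f<k = midTerm-bound (inner f) 0<k (λ i → f<k (suc (inject₁ i)))

-- The two ends agree and contribute one doubled term; the rest is a shorter palindrome.
sum-palindromic : (f : Vector ℕ n) → Palindromic f → sum f ≡ midTerm n f + sum (f ∘ half) * 2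
sum-palindromic {0}           f pal = refl
sum-palindromic {1}           f pal = refl
sum-palindromic {suc (suc n)} f pal = begin
  f zero + sum (f ∘ suc)                           ≡⟨ cong (f zero +_) (sum-init-last (f ∘ suc)) ⟩
  f zero + (sum (inner f) + f (suc (fromℕ n)))     ≡⟨ cong (λ x → f zero + (sum (inner f) + x)) (pal zero) ⟨
  f zero + (sum (inner f) + f zero)                ≡⟨ cong (λ x → f zero + (x + f zero)) (sum-palindromic (inner f) (inner-palindromic f pal)) ⟩
  f zero + (midTerm n (inner f) + sum (inner f ∘ half) * 2 + f zero)
    ≡⟨ solve 3 (λ x c s → x :+ (c :+ s :* con 2 :+ x) := c :+ (x :+ s) :* con 2) refl (f zero) (midTerm n (inner f)) _ ⟩
  midTerm n (inner f) + (f zero + sum (inner f ∘ half)) * 2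
    ≡⟨ cong (λ x → midTerm n (inner f) + (f zero + x) * 2) (sum-cong-≗ (λ i → cong f (half-suc i))) ⟨
  midTerm n (inner f) + sum (f ∘ half) * 2         ∎
  where
  open ≡-Reasoning
  open +-*-Solver

-- Folding indices onto a half

-- The quotient by reversal: mirror indices have the same image, and `nothing` is the fixed central
-- index of an odd `n`.
fold : Fin n → Maybe (Fin ⌊ n /2⌋)
fold {1}           zero    = nothing
fold {suc (suc n)} zero    = just zero
fold {suc (suc n)} (suc i) with view i
... | ‵fromℕ     = just zero
... | ‵inject₁ j = Maybe.map suc (fold j)

fold-last : ∀ n → fold (suc (fromℕ n)) ≡ just zero
fold-last n rewrite view-fromℕ n = refl

fold-inner : (i : Fin n) → fold {2 + n} (suc (inject₁ i)) ≡ Maybe.map suc (fold i)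
fold-inner i rewrite view-inject₁ i = refl

fold-opposite : (i : Fin n) → fold (opposite i) ≡ fold i
fold-opposite {1}           zero    = refl
fold-opposite {suc (suc n)} zero    = fold-last n
fold-opposite {suc (suc n)} (suc i) with view i
... | ‵fromℕ     = cong (fold ∘ inject₁) (opposite-fromℕ n)
... | ‵inject₁ j = begin
  fold (inject₁ (opposite (inject₁ j)))  ≡⟨ cong (fold ∘ inject₁) (opposite-inject₁ j) ⟩
  fold (suc (inject₁ (opposite j)))      ≡⟨ fold-inner (opposite j) ⟩
  Maybe.map suc (fold (opposite j))      ≡⟨ cong (Maybe.map suc) (fold-opposite j) ⟩
  Maybe.map suc (fold j)                 ∎
  where open ≡-Reasoning

fold-half : (i : Fin ⌊ n /2⌋) → fold (half i) ≡ just i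
fold-half {suc (suc n)} zero    = refl
fold-half {suc (suc n)} (suc i) = begin
  fold (half (suc i))              ≡⟨ cong fold (half-suc i) ⟩
  fold (suc (inject₁ (half i)))    ≡⟨ fold-inner (half i) ⟩
  Maybe.map suc (fold (half i))    ≡⟨ cong (Maybe.map suc) (fold-half i) ⟩
  just (suc i)                     ∎
  where open ≡-Reasoning

fold-mid : .{{_ : NonZero n}} → Odd n → fold (mid n) ≡ nothing
fold-mid {1}                 odd = refl
fold-mid {2}                 odd = contradiction ∣-refl odd
fold-mid {suc (suc (suc n))} odd = begin
  fold (mid (3 + n))                  ≡⟨ cong fold (mid-suc {suc n}) ⟩
  fold (suc (inject₁ (mid (1 + n))))  ≡⟨ fold-inner (mid (1 + n)) ⟩
  Maybe.map suc (fold (mid (1 + n)))  ≡⟨ cong (Maybe.map suc) (fold-mid (Odd-2+⁻ odd)) ⟩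
  nothing                             ∎
  where open ≡-Reasoning

fold-nothing : .{{_ : NonZero n}} (i : Fin n) → fold i ≡ nothing → Odd n × i ≡ mid n
fold-nothing {1}           zero    _  = (λ even → contradiction (∣1⇒≡1 even) (λ ())) , refl
fold-nothing {suc (suc n)} (suc i) eq with view i
... | ‵inject₁ j with fold j in eq′
... | nothing =
  -- `mid` on the inner range requires a nonzero length, which the index `j` witnesses.
  let instance _ = nonZeroIndex j
      odd , j≡mid = fold-nothing j eq′
  in (λ even → odd (Even-2+⁻ even)) , trans (cong (Fin.suc ∘ inject₁) j≡mid) (sym mid-suc)

-- `i` is either `half i′` or its mirror image.
fold-just : (f : Vector ℕ n) → Palindromic f → ∀ {i i′} → fold i ≡ just i′ → f i ≡ f (half i′)
fold-just {suc (suc n)} f pal {zero}  refl = refl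
fold-just {suc (suc n)} f pal {suc i} eq   with view i
fold-just {suc (suc n)} f pal {suc .(fromℕ n)} refl | ‵fromℕ = sym (pal zero)
... | ‵inject₁ j with fold j in eq′
... | just j′ with refl ← eq =
  trans (fold-just (inner f) (inner-palindromic f pal) eq′) (cong f (sym (half-suc j′)))

halves-palindromic : (c : Vector (Fin 2) n) → (∀ j → c j ≡ c (opposite j)) →
                     ⌊ total c /2⌋ ≡ total (c ∘ half) × total c % 2 ≡ midTerm n (toℕ ∘ c)
halves-palindromic {n} c pal
  rewrite sum-palindromic (toℕ ∘ c) (λ j → cong toℕ (pal j)) =
  ⌊b+x*2/2⌋≡x bit (total (c ∘ half)) , [b+x*2]%2≡b bit (total (c ∘ half))
  where bit = midTerm-bound (toℕ ∘ c) z<s (λ j → toℕ<n (c j))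

-- Necessity of the conditions

-- Every claim about columns is obtained from the one about rows. Transposition exchanges the
-- reflections `r₀` and `r∞`.
transpose⁺ : {R : Vector ℕ m} {S : Vector ℕ n} → A⁺ R S → A⁺ S R
transpose⁺ A = record
  { matrix    = flip matrix
  ; rowSum    = colSum
  ; colSum    = rowSum
  ; invariant = λ { ρ₀ i j → refl ; ρπ i j → invariant ρπ j i ; r₀ i j → invariant r∞ j i ; r∞ i j → invariant r₀ j i }
  }
  where open A⁺ A

module _ {R : Vector ℕ m} {S : Vector ℕ n} (A : A⁺ R S) where
  open A⁺ A
  open ≡-Reasoning

  A⁺⇒Palindromic : Palindromic R
  A⁺⇒Palindromic i = begin
    R i                                      ≡⟨ rowSum i ⟨
    sum (λ j → toℕ (matrix i j))             ≡⟨ sum-cong-≗ (λ j → cong toℕ (invariant r₀ i j)) ⟨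
    sum (λ j → toℕ (matrix (opposite i) j))  ≡⟨ rowSum (opposite i) ⟩
    R (opposite i)                           ∎

  A⁺⇒halves : ∀ i → ⌊ R i /2⌋ ≡ total (matrix i ∘ half) × R i % 2 ≡ midTerm n (toℕ ∘ matrix i)
  A⁺⇒halves i = subst (λ x → ⌊ x /2⌋ ≡ total (matrix i ∘ half) × x % 2 ≡ midTerm n (toℕ ∘ matrix i))
    (rowSum i) (halves-palindromic (matrix i) (λ j → sym (invariant r∞ i j)))

  A⁺⇒Even : Even n → ∀ i → Even (R i)
  A⁺⇒Even even i = m%n≡0⇒n∣m (R i) 2 (trans (proj₂ (A⁺⇒halves i)) (midTerm-Even (toℕ ∘ matrix i) even))

  -- The parity of a row sum is the entry of that row in the central column, so adding the parities
  -- gives the sum of this column.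
  A⁺⇒#odd : .{{_ : NonZero n}} → Odd n → #odd R ≡ S (mid n)
  A⁺⇒#odd odd = begin
    #odd R                                        ≡⟨ #odd≡sum-%2 R ⟩
    sum (λ i → R i % 2)                           ≡⟨ sum-cong-≗ (λ i → proj₂ (A⁺⇒halves i)) ⟩
    sum (λ i → midTerm n (toℕ ∘ matrix i))        ≡⟨ sum-cong-≗ (λ i → midTerm-Odd (toℕ ∘ matrix i) odd) ⟩
    sum (λ i → toℕ (matrix i (mid n)))            ≡⟨ colSum (mid n) ⟩
    S (mid n)                                     ∎

-- The quadrant of first halves has the entries of `check R` and `check S` as its line sums.
A⁺⇒⪯ : {R : Vector ℕ m} {S : Vector ℕ n} → A⁺ R S → toList (check S) ⪯ conjugate (toList (check R))
A⁺⇒⪯ A = gale-ryser-necessary (λ i j → A⁺.matrix A (half i) (half j))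
  (λ i → sym (proj₁ (A⁺⇒halves A (half i))))
  (λ j → sym (proj₁ (A⁺⇒halves (transpose⁺ A) (half j))))

-- Unfolding a quadrant

bit : ℕ → Fin 2
bit x = x mod 2

toℕ-bit : ∀ x → toℕ (bit x) ≡ x % 2
toℕ-bit x = toℕ-fromℕ< (m%n<n x 2)

-- `nothing` marks the central line, on which the entry is the parity of the
-- sum of the line crossing it.
entry : Matrix m n → Maybe (Fin m) → Maybe (Fin n) → ℕ → ℕ → Fin 2
entry Q (just i) (just j) x y = Q i j
entry Q (just i) nothing  x y = bit x
entry Q nothing  _        x y = bit y

unfold : Matrix ⌊ m /2⌋ ⌊ n /2⌋ → Vector ℕ m → Vector ℕ n → Matrix m n
unfold Q R S i j = entry Q (fold i) (fold j) (R i) (S j)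

module _ .{{_ : NonZero m}} .{{_ : NonZero n}} (Q : Matrix ⌊ m /2⌋ ⌊ n /2⌋)
         (R : Vector ℕ m) (S : Vector ℕ n) (R-pal : Palindromic R) (S-pal : Palindromic S) where

  -- An entry depends only on folded indices and line sums, and reversal changes neither.
  unfold-invariant : ∀ g i j → (g · unfold Q R S) i j ≡ unfold Q R S i j
  unfold-invariant ρ₀ i j = refl
  unfold-invariant ρπ i j rewrite fold-opposite i | fold-opposite j | sym (R-pal i) | sym (S-pal j) = refl
  unfold-invariant r₀ i j rewrite fold-opposite i | sym (R-pal i) = refl
  unfold-invariant r∞ i j rewrite fold-opposite j | sym (S-pal j) = refl

  unfold-rowSum : (∀ i → total (Q i) ≡ check R i) → (Even n → ∀ i → Even (R i)) →
                  (Odd m → #odd S ≡ R (mid m)) → ∀ i → total (unfold Q R S i) ≡ R i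
  unfold-rowSum rows even-R #odd-S i with fold i in eq
  ... | just i′ = begin
    sum row                                              ≡⟨ sum-palindromic row row-pal ⟩
    midTerm n row + sum (row ∘ half) * 2                 ≡⟨ cong₂ (λ b x → b + x * 2) middle sides ⟩
    R i % 2 + ⌊ R i /2⌋ * 2                              ≡⟨ halves (R i) ⟩
    R i                                                  ∎
    where
    open ≡-Reasoning
    row : Vector ℕ n
    row j = toℕ (entry Q (just i′) (fold j) (R i) (S j))
    row-pal : Palindromic row
    row-pal j rewrite fold-opposite j | sym (S-pal j) = refl
    middle : midTerm n row ≡ R i % 2
    middle with 2 ∣? n
    -- There is no central column, and `even-R` makes the parity 0 as well.
    ... | yes even = trans (midTerm-Even row even) (sym (Even⇒%2≡0 (even-R even i)))
    ... | no  odd  = trans (midTerm-Odd row odd)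
      (trans (cong (λ f → toℕ (entry Q (just i′) f (R i) (S (mid n)))) (fold-mid odd)) (toℕ-bit (R i)))
    sides : sum (row ∘ half) ≡ ⌊ R i /2⌋
    sides = begin
      sum (row ∘ half)       ≡⟨ sum-cong-≗ (λ j → cong (λ f → toℕ (entry Q (just i′) f (R i) (S (half j)))) (fold-half j)) ⟩
      total (Q i′)           ≡⟨ rows i′ ⟩
      -- `check R` only sees the first half of `R`; a row in the second half is treated through its
      -- mirror image.
      ⌊ R (half i′) /2⌋      ≡⟨ cong ⌊_/2⌋ (fold-just R R-pal eq) ⟨
      ⌊ R i /2⌋              ∎
  -- The central row consists of the parities of `S`, so its sum is the number of odd entries.
  ... | nothing = begin
    total (bit ∘ S)          ≡⟨ sum-cong-≗ (λ j → toℕ-bit (S j)) ⟩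
    sum (λ j → S j % 2)      ≡⟨ #odd≡sum-%2 S ⟨
    #odd S                   ≡⟨ #odd-S (proj₁ (fold-nothing i eq)) ⟩
    R (mid m)                ≡⟨ cong R (proj₂ (fold-nothing i eq)) ⟨
    R i                      ∎
    where open ≡-Reasoning

  -- The construction treats rows and columns alike except where the central lines cross: there
  -- `entry` takes the column parity, its transpose the row parity, and `centre` identifies them.
  unfold-transpose : (Odd m → Odd n → R (mid m) % 2 ≡ S (mid n) % 2) →
                     ∀ i j → unfold Q R S i j ≡ unfold (flip Q) S R j i
  unfold-transpose centre i j with fold i in eqᵢ | fold j in eqⱼ
  ... | just _  | just _  = refl
  ... | just _  | nothing = refl
  ... | nothing | just _  = refl
  ... | nothing | nothing with fold-nothing i eqᵢ | fold-nothing j eqⱼ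
  ... | odd-m , refl | odd-n , refl = toℕ-injective
    (trans (toℕ-bit (S (mid n))) (trans (sym (centre odd-m odd-n)) (sym (toℕ-bit (R (mid m))))))

-- By the two equalities of (c), each central sum counts the odd entries of the other vector, which
-- has the parity of the common total.
#odd-centre : .{{_ : NonZero m}} .{{_ : NonZero n}} (R : Vector ℕ m) (S : Vector ℕ n) → sum R ≡ sum S →
              #odd R ≡ S (mid n) → #odd S ≡ R (mid m) → R (mid m) % 2 ≡ S (mid n) % 2
#odd-centre {m} {n} R S ΣR≡ΣS #odd-R #odd-S = begin
  R (mid m) % 2   ≡⟨ cong (_% 2) #odd-S ⟨
  #odd S % 2      ≡⟨ #odd%2≡sum%2 S ⟩
  sum S % 2       ≡⟨ cong (_% 2) ΣR≡ΣS ⟨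
  sum R % 2       ≡⟨ #odd%2≡sum%2 R ⟨
  #odd R % 2      ≡⟨ cong (_% 2) #odd-R ⟩
  S (mid n) % 2   ∎
  where open ≡-Reasoning

theorem14 : ∀ (m n : ℕ) .{{_ : NonZero m}} .{{_ : NonZero n}}
    (R : Vector ℕ m) (S : Vector ℕ n) →
    (∀ i → R i ≤ n) → (∀ j → S j ≤ m) → sum R ≡ sum S →
    A⁺ R S ⇔
    ( (Palindromic R × Palindromic S)
    × ( (Even n → ∀ i → Even (R i)) × (Odd n → S (mid n) ≥ #odd R)
    × (Even m → ∀ j → Even (S j)) × (Odd m → R (mid m) ≥ #odd S))
    × ((Odd n → #odd R ≡ S (mid n)) × (Odd m → #odd S ≡ R (mid m)))
    × toList (check S) ⪯ conjugate (toList (check R)))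
theorem14 m n R S _ _ ΣR≡ΣS = mk⇔
  (λ A → let Aᵀ = transpose⁺ A in
      (A⁺⇒Palindromic A , A⁺⇒Palindromic Aᵀ)
    , (A⁺⇒Even A , (λ odd → ≤-reflexive (A⁺⇒#odd A odd)) , A⁺⇒Even Aᵀ , (λ odd → ≤-reflexive (A⁺⇒#odd Aᵀ odd)))
    , (A⁺⇒#odd A , A⁺⇒#odd Aᵀ)
    , A⁺⇒⪯ A)
  λ ((R-pal , S-pal) , (even-R , _ , even-S , _) , (#odd-R , #odd-S) , Š⪯Ř*) →
    let Q , rows , cols = gale-ryser-sufficient (check R) (check S) Š⪯Ř*
        transposed = unfold-transpose Q R S R-pal S-pal
          (λ odd-m odd-n → #odd-centre R S ΣR≡ΣS (#odd-R odd-n) (#odd-S odd-m))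
    in record
      { matrix    = unfold Q R S
      ; rowSum    = unfold-rowSum Q R S R-pal S-pal rows even-R #odd-S
      -- The columns are the rows of the matrix unfolded from the transposed quadrant.
      ; colSum    = λ j → trans (sum-cong-≗ (λ i → cong toℕ (transposed i j)))
          (unfold-rowSum (flip Q) S R S-pal R-pal cols even-S #odd-R j)
      ; invariant = unfold-invariant Q R S R-pal S-pal
      }
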